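{- Let $T$ be a nonspecial, well-pruned $\omega_1$-tree. Then $\diamondsuit_T^{ - }$ and $\diamondsuit_T$ are equivalent.
   Context: A tree is a partial order $(T,<_T)$ in which the set of predecessors of each node is well-ordered; every tree is assumed to have a root, denoted $\emptyset$. For $t\in T$, $t{\downarrow}=\{s\in T\mid s<_T t\}$, $\mathrm{ht}(t)$ is the order type of $t{\downarrow}$, and $T_\alpha$ is the set of nodes of height $\alpha$. The height of $T$ is the least $\alpha$ with $T_\alpha=\emptyset$. An $\omega_1$-tree is a tree of height $\omega_1$ all of whose levels $T_\alpha$ are countable. A tree $T$ of height $\kappa$ is well-pruned if for all $\alpha<\beta<\kappa$ and $s\in T_\alpha$ there is $t\in T_\beta$ with $s<_T t$. An antichain is a set of pairwise incomparable nodes. A set $U\subseteq T$ is special if it is a union of at most countably many antichains; otherwise it is nonspecial. For $X\subseteq T$, a map $f:X\to T$ is regressive if $f(t)<_T t$ for all $t\in X\setminus\{\emptyset\}$. For $T$ of height $\omega_1$, $NS^T$ is the ideal of all $B\subseteq T$ for which there is a regressive $f:B\to T$ such that $f^{ -1}(\{t\})$ is special for every $t\in T$. For a nonspecial tree $T$ of height $\omega_1$: $\diamondsuit_T$ asserts that there is a sequence $(D_t\mid t\in T)$ with $D_t\subseteq t{\downarrow}$ for all $t\in T$ such that for every $X\subseteq T$, $\{t\in T\mid X\cap t{\downarrow}=D_t\}\notin NS^T$. $\diamondsuit_T^{ - }$ asserts that there is a sequence $(\mathcal D_t\mid t\in T)$ with $\mathcal D_t\subseteq\mathcal P(t{\downarrow})$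 and $|\mathcal D_t|\le\omega$ for all $t\in T$ such that for every $X\subseteq T$, $\{t\in T\mid X\cap t{\downarrow}\in\mathcal D_t\}\notin NS^T$. -}

module Defs where

open import Data.Nat.Base using (ℕ)
open import Data.Product using (Σ; ∃; _×_; _,_; proj₁)
open import Function.Bundles using (Func; Injection)
open import Function.Base using (_on_)
open import Induction.WellFounded using (WellFounded)
open import Level using (Level; suc; _⊔_)
open import Relation.Binary.Bundles using (Setoid)
open import Relation.Binary.Core using (Rel)
open import Relation.Binary.Definitions using (Minimum; _Respects_)
open import Relation.Binary.Morphism.Structures using (IsOrderIsomorphism)
open import Relation.Binary.PropositionalEquality using (_≡_; _≢_; setoid)
open import Relation.Binary.Structures using (IsStrictPartialOrder; IsStrictTotalOrder)
import Relation.Binary.Construct.On as On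
import Relation.Binary.Construct.StrictToNonStrict as StrictToNonStrict
open import Relation.Nullary using (¬_)
open import Relation.Unary
  using (Pred; _∈_; _⊆_; _≐_; _∩_; U; Empty; ⋃)
open import Relation.Unary.Relation.Binary.Equality using (≐-setoid)

private
  variable
    a ℓ p : Level

-- Membership proofs are ignored: elements of a subset are compared in
-- the ambient setoid.
subsetoid : (S : Setoid a ℓ) → Pred (Setoid.Carrier S) p → Setoid (a ⊔ p) ℓ
subsetoid S P = On.setoid S (proj₁ {B = P})

-- At most countable.
Countable : Setoid a ℓ → Set (a ⊔ ℓ)
Countable S = Injection S (setoid ℕ)

record IsWellOrder {A : Set a} (_≈_ _<_ : Rel A ℓ) : Set (a ⊔ ℓ) where
  field
    isStrictTotalOrder : IsStrictTotalOrder _≈_ _<_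
    wellFounded        : WellFounded _<_

  open IsStrictTotalOrder isStrictTotalOrder public

-- Ordinals are represented by well-orders up to order isomorphism _≅_.
record WellOrder (a : Level) : Set (suc a) where
  infix 4 _≈_ _<_
  field
    Carrier     : Set a
    _≈_         : Rel Carrier a
    _<_         : Rel Carrier a
    isWellOrder : IsWellOrder _≈_ _<_

  open IsWellOrder isWellOrder public

  asSetoid : Setoid a a
  asSetoid = record { isEquivalence = isEquivalence }

-- The initial segment { β ∣ β < α }. The ordinals below κ are exactly
-- the order types of the segments κ ↾ α.
infixl 6 _↾_
_↾_ : (κ : WellOrder a) → WellOrder.Carrier κ → WellOrder a
κ ↾ α = record
  { Carrier     = Σ Carrier (_< α)
  ; _≈_         = _≈_ on proj₁
  ; _<_         = _<_ on proj₁
  ; isWellOrder = record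
    { isStrictTotalOrder = On.isStrictTotalOrder proj₁ isStrictTotalOrder
    ; wellFounded        = On.wellFounded proj₁ wellFounded
    }
  }
  where open WellOrder κ

infix 4 _≅_
_≅_ : WellOrder a → WellOrder a → Set a
κ ≅ μ = ∃ λ f → IsOrderIsomorphism κ._≈_ μ._≈_ κ._<_ μ._<_ f
  where
  module κ = WellOrder κ
  module μ = WellOrder μ

-- κ is (a representative of) ω₁, the least uncountable ordinal.
IsOmega₁ : WellOrder a → Set a
IsOmega₁ κ =
  ¬ Countable (WellOrder.asSetoid κ) ×
  (∀ α → Countable (WellOrder.asSetoid (κ ↾ α)))

record Tree (a : Level) : Set (suc a) where
  infix 4 _<_
  field
    Node                 : Set a
    _<_                  : Rel Node a
    isStrictPartialOrder : IsStrictPartialOrder _≡_ _<_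
    ↓-isWellOrder        : ∀ t → IsWellOrder {A = Σ Node (_< t)}
                                             (_≡_ on proj₁) (_<_ on proj₁)
    root                 : Node
    root-minimum         : Minimum (StrictToNonStrict._≤_ _≡_ _<_) root

module _ (T : Tree a) where
  open Tree T

  infix 9 _↓
  _↓ : Node → Pred Node a
  t ↓ = _< t

  predecessors : Node → WellOrder a
  predecessors t = record { isWellOrder = ↓-isWellOrder t }

  -- ht(t) = α is expressed as predecessors t ≅ α.
  LevelAt : WellOrder a → Pred Node a
  LevelAt α t = predecessors t ≅ α

  HasHeight : WellOrder a → Set a
  HasHeight κ = Empty (LevelAt κ) × (∀ α → ¬ Empty (LevelAt (κ ↾ α)))

  IsOmega₁Tree : Set (suc a)
  IsOmega₁Tree =
    (∃ λ κ → IsOmega₁ κ × HasHeight κ) ×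
    (∀ α → Countable (subsetoid (setoid Node) (LevelAt α)))

  WellPruned : Set (suc a)
  WellPruned = ∀ κ → HasHeight κ → ∀ {α β} → WellOrder._<_ κ α β →
    ∀ {s} → s ∈ LevelAt (κ ↾ α) → ∃ λ t → t ∈ LevelAt (κ ↾ β) × s < t

  Antichain : Pred Node p → Set (a ⊔ p)
  Antichain A = ∀ {s t} → s ∈ A → t ∈ A → s ≢ t → ¬ (s < t) × ¬ (t < s)

  -- Indexing by ℕ loses nothing, as the empty set is an antichain.
  Special : Pred Node p → Set (suc a ⊔ p)
  Special B = ∃ λ (A : ℕ → Pred Node a) → (∀ n → Antichain (A n)) × B ≐ ⋃ ℕ A

  Nonspecial : Set (suc a)
  Nonspecial = ¬ Special U

  module _ {X : Pred Node a} (f : Func (subsetoid (setoid Node) X) (setoid Node)) where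

    Regressive : Set a
    Regressive = ∀ {t} (t∈X : t ∈ X) → t ≢ root → Func.to f (t , t∈X) < t

    fibre : Node → Pred Node a
    fibre t s = ∃ λ (s∈X : s ∈ X) → Func.to f (s , s∈X) ≡ t

  NS : Pred Node a → Set (suc a)
  NS B = ∃ λ (f : Func (subsetoid (setoid Node) B) (setoid Node)) →
    Regressive f × (∀ t → Special (fibre f t))

  ◇ : Set (suc a)
  ◇ = ∃ λ (D : Node → Pred Node a) →
    (∀ t → D t ⊆ t ↓) ×
    (∀ (X : Pred Node a) → ¬ NS (λ t → X ∩ t ↓ ≐ D t))

  -- A family of subsets has to respect extensional equality ≐ of
  -- subsets, and is counted up to it.
  ◇⁻ : Set (suc a)
  ◇⁻ = ∃ λ (𝒟 : Node → Pred (Pred Node a) a) →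
    (∀ t → 𝒟 t Respects _≐_) ×
    (∀ t {D} → D ∈ 𝒟 t → D ⊆ t ↓) ×
    (∀ t → Countable (subsetoid (≐-setoid Node a) (𝒟 t))) ×
    (∀ (X : Pred Node a) → ¬ NS (λ t → X ∩ t ↓ ∈ 𝒟 t))

{-# OPTIONS --safe #-}

-- Kunen's argument on trees. Sets X₀, X₁, … ⊆ T are coded by a single Y ⊆ T:
-- a node s at distance n above a node l without immediate predecessor is, for
-- the index m, represented by the nodes at distance pair m n above l that
-- extend s. If t has no immediate predecessor, Y ∩ t↓ then determines every
-- Xₘ ∩ t↓, and the other nodes t form a set in NS, since mapping a node to its
-- immediate predecessor has antichains as fibres. So if E t n (n ∈ ℕ)
-- enumerates a ◇⁻-sequence and, for every n, some Xₙ witnessed that decoding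
-- E t n at index n does not give a ◇-sequence, then the code of the Xₙ would
-- contradict ◇⁻, as NS is a σ-ideal.
module Submission where

open import Defs
open import Axiom.ExcludedMiddle using (ExcludedMiddle)
open import Function.Bundles using (_⇔_; mk⇔; Func; Injection)
open import Level using (Level; suc; Lift; lift; lower)

open import Data.Nat.Base as ℕ using (ℕ; zero; _+_; _*_)
import Data.Nat.Properties as ℕₚ
open import Data.Product using (∃; _×_; _,_; proj₁; proj₂)
open import Data.Sum using (_⊎_; inj₁; inj₂)
open import Function.Base using (_∘_; _on_)
open import Induction.WellFounded using (Acc; acc; WellFounded)
open import Relation.Binary.Definitions using (tri<; tri≈; tri>)
open import Relation.Binary.PropositionalEquality
  using (_≡_; refl; sym; trans; cong)
open import Relation.Binary.Structures using (IsStrictPartialOrder)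
open import Relation.Nullary using (¬_; Dec; yes; no; contradiction)
open import Relation.Nullary.Decidable using (map′; decidable-stable)
open import Relation.Unary using (Pred; _∈_; _⊆_; _≐_; _∩_; ⋃)
open import Relation.Unary.Polymorphic using (∅)

-- A pairing function on the natural numbers.

pair : ℕ → ℕ → ℕ
pair m n = (m + n) * (m + n) + n

-- Pairs with sum `s` take values from s² to s² + s, all below (s + 1)².
pair-mono-< : ∀ m n m′ n′ → m + n ℕ.< m′ + n′ → pair m n ℕ.< pair m′ n′
pair-mono-< m n m′ n′ s<s′ = begin-strict
  s * s + n               ≤⟨ ℕₚ.+-monoʳ-≤ (s * s) (ℕₚ.m≤n+m n m) ⟩
  s * s + s               ≡⟨ ℕₚ.+-comm (s * s) s ⟩
  s + s * s               <⟨ ℕₚ.m<n+m (s + s * s) {ℕ.suc s} (ℕ.s≤s ℕ.z≤n) ⟩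
  ℕ.suc s + (s + s * s)   ≡⟨ cong (ℕ.suc s +_) (ℕₚ.*-suc s s) ⟨
  ℕ.suc s * ℕ.suc s       ≤⟨ ℕₚ.*-mono-≤ s<s′ s<s′ ⟩
  (m′ + n′) * (m′ + n′)   ≤⟨ ℕₚ.m≤m+n _ n′ ⟩
  pair m′ n′              ∎
  where
  open ℕₚ.≤-Reasoning
  s = m + n

pair-injective : ∀ m n m′ n′ → pair m n ≡ pair m′ n′ → m ≡ m′ × n ≡ n′
pair-injective m n m′ n′ eq with ℕₚ.<-cmp (m + n) (m′ + n′)
... | tri< lt _ _ = contradiction eq (ℕₚ.<⇒≢ (pair-mono-< m n m′ n′ lt))
... | tri> _ _ gt = contradiction (sym eq) (ℕₚ.<⇒≢ (pair-mono-< m′ n′ m n gt))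
... | tri≈ _ s≡s′ _ = m≡m′ , n≡n′
  where
  n≡n′ : n ≡ n′
  n≡n′ = ℕₚ.+-cancelˡ-≡ ((m + n) * (m + n)) n n′
    (trans eq (cong (λ s → s * s + n′) (sym s≡s′)))

  m≡m′ : m ≡ m′
  m≡m′ = ℕₚ.+-cancelʳ-≡ n m m′ (trans s≡s′ (cong (m′ +_) (sym n≡n′)))

module _ {a : Level} (T : Tree a) where
  open Tree T
  open IsStrictPartialOrder isStrictPartialOrder
    using () renaming (trans to <-trans)

  -- Special sets and the ideal `NS`.

  antichain⇒special : {A : Pred Node a} → Antichain T A → Special T A
  antichain⇒special {A} anti =
    (λ _ → A) , (λ _ {s} {t} → anti {s} {t}) , (λ x → 0 , x) , proj₂

  special-⊆ : {P Q : Pred Node a} → P ⊆ Q → Special T Q → Special T P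
  special-⊆ {P} P⊆Q (A , anti , Q⊆A , _) =
    (λ n → A n ∩ P) ,
    (λ { n (s∈A , _) (t∈A , _) → anti n s∈A t∈A }) ,
    (λ x → let n , x∈A = Q⊆A (P⊆Q x) in n , x∈A , x) ,
    (λ { (_ , _ , x) → x })

  special-⋃ : {P : ℕ → Pred Node a} → (∀ n → Special T (P n)) → Special T (⋃ ℕ P)
  special-⋃ {P} sp = A , anti , to , from
    where
    -- As `pair` is injective, each `A k` is one of the given antichains or empty.
    A : ℕ → Pred Node a
    A k t = ∃ λ m → ∃ λ n → pair m n ≡ k × t ∈ proj₁ (sp m) n

    anti : ∀ k → Antichain T (A k)
    anti _ (m , n , eq , s∈A) (m′ , n′ , eq′ , t∈A)
      with pair-injective m n m′ n′ (trans eq (sym eq′))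
    ... | refl , refl = proj₁ (proj₂ (sp m)) n s∈A t∈A

    to : ⋃ ℕ P ⊆ ⋃ ℕ A
    to (m , x) = let n , x∈A = proj₁ (proj₂ (proj₂ (sp m))) x
                 in pair m n , m , n , refl , x∈A

    from : ⋃ ℕ A ⊆ ⋃ ℕ P
    from (_ , m , n , _ , x∈A) = m , proj₂ (proj₂ (proj₂ (sp m))) (n , x∈A)

  NS-⊆ : {B C : Pred Node a} → B ⊆ C → NS T C → NS T B
  NS-⊆ B⊆C (f , regr , fib) =
    record
      { to   = λ { (t , t∈B) → Func.to f (t , B⊆C t∈B) }
      ; cong = Func.cong f
      } ,
    (λ t∈B → regr (B⊆C t∈B)) ,
    (λ t → special-⊆ (λ { (s∈B , eq) → B⊆C s∈B , eq }) (fib t))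

  -- Immediate predecessors and finite distances.

  <-wellFounded : WellFounded _<_
  <-wellFounded t =
    acc λ u<t → restrict (IsWellOrder.wellFounded (↓-isWellOrder t) (_ , u<t))
    where
    restrict : ∀ {u} {u<t : u < t} → Acc (_<_ on proj₁) (u , u<t) → Acc _<_ u
    restrict {u<t = u<t} (acc rs) =
      -- Nodes below `u` stay below `t`, so accessibility in the segment of `t` carries over to the
      -- tree.
      acc λ v<u → restrict (rs {_ , <-trans v<u u<t} v<u)

  infix 4 _⋖_ _⋖[_]_

  _⋖_ : Node → Node → Set a
  s ⋖ t = s < t × ¬ (∃ λ r → s < r × r < t)

  ⋖-unique : ∀ {s s′ t} → s ⋖ t → s′ ⋖ t → s ≡ s′
  ⋖-unique {t = t} (s<t , ¬s) (s′<t , ¬s′)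
    with IsWellOrder.compare (↓-isWellOrder t) (_ , s<t) (_ , s′<t)
  ... | tri< lt _ _ = contradiction (_ , lt , s′<t) ¬s
  ... | tri≈ _ eq _ = eq
  ... | tri> _ _ gt = contradiction (_ , gt , s<t) ¬s′

  HasPred : Pred Node a
  HasPred t = ∃ λ s → s ⋖ t

  -- If `s < t` shared the immediate predecessor `v`, then `s` would lie strictly between `v` and
  -- `t`.
  NS-hasPred : NS T HasPred
  NS-hasPred =
    record { to = proj₁ ∘ proj₂
           ; cong = λ { {_ , _ , p} {_ , _ , q} refl → ⋖-unique p q } } ,
    (λ { (_ , s<t , _) _ → s<t }) ,
    (λ v → antichain⇒special
      λ { ((_ , v<s , ¬s) , refl) ((_ , v<t , ¬t) , refl) _ →
          (λ s<t → ¬t (_ , v<s , s<t)) , (λ t<s → ¬s (_ , v<t , t<s)) })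

  data _⋖[_]_ (s : Node) : ℕ → Node → Set a where
    here : s ⋖[ 0 ] s
    step : ∀ {n t u} → s ⋖[ n ] t → t ⋖ u → s ⋖[ ℕ.suc n ] u

  ⋖[]-unique : ∀ {n s s′ t} → s ⋖[ n ] t → s′ ⋖[ n ] t → s ≡ s′
  ⋖[]-unique here       here         = refl
  ⋖[]-unique (step c p) (step c′ p′) with ⋖-unique p p′
  ... | refl = ⋖[]-unique c c′

  ⋖[]-trans : ∀ {m n s t u} → s ⋖[ m ] t → t ⋖[ n ] u → s ⋖[ n + m ] u
  ⋖[]-trans c here       = c
  ⋖[]-trans c (step d p) = step (⋖[]-trans c d) p

  -- t has height λ + n with λ a limit or 0.
  Offset : ℕ → Pred Node a
  Offset n t = ∃ λ l → ¬ HasPred l × l ⋖[ n ] t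

  Offset-unique : ∀ {m n t} → Offset m t → Offset n t → m ≡ n
  Offset-unique (_ , _ , here)      (_ , _ , here)        = refl
  Offset-unique (_ , ¬p , here)     (_ , _ , step _ q)    = contradiction (_ , q) ¬p
  Offset-unique (_ , _ , step _ p)  (_ , ¬q , here)       = contradiction (_ , p) ¬q
  Offset-unique (l , l¬ , step c p) (l′ , l′¬ , step d q) with ⋖-unique p q
  ... | refl = cong ℕ.suc (Offset-unique (l , l¬ , c) (l′ , l′¬ , d))

  -- Coding countably many sets by one.

  Codes : ℕ → Node → Node → Set a
  Codes m s u = ∃ λ n → Offset n s × s ⋖[ (m + n) * (m + n) ] u

  -- Climbing (m + n)² steps from offset `n` ends at offset `pair m n`. So the offset of `u` yields
  -- `m` and `n`, and `s` is the only node that many steps below `u`.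
  Codes-injective : ∀ {m m′ s s′ u} → Codes m s u → Codes m′ s′ u → m ≡ m′ × s ≡ s′
  Codes-injective {m} {m′} (n , (_ , l¬ , c) , d) (n′ , (_ , l′¬ , c′) , d′)
    with pair-injective m n m′ n′
           (Offset-unique (_ , l¬ , ⋖[]-trans c d) (_ , l′¬ , ⋖[]-trans c′ d′))
  ... | refl , refl = refl , ⋖[]-unique d d′

  encode : (ℕ → Pred Node a) → Pred Node a
  encode X u = ∃ λ m → ∃ λ s → Codes m s u × s ∈ X m

  -- The clause `s < t` keeps the result inside `t ↓` whatever `Y` is, as `◇` demands.
  decode : ℕ → Node → Pred Node a → Pred Node a
  decode m t Y s = s < t × ∃ λ u → Codes m s u × u ∈ Y

  decode-encode-⊆ : ∀ X m t → decode m t (encode X) ⊆ X m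
  decode-encode-⊆ X m t (_ , u , c , m′ , s′ , c′ , s′∈X) with Codes-injective {m} {m′} c c′
  ... | refl , refl = s′∈X

  -- From `◇` to `◇⁻`.

  ◇⇒◇⁻ : ◇ T → ◇⁻ T
  ◇⇒◇⁻ (D , D⊆↓ , guess) =
    (λ t E → E ≐ D t) ,
    (λ { t (E⊆F , F⊆E) (E⊆D , D⊆E) → (E⊆D ∘ F⊆E) , (E⊆F ∘ D⊆E) }) ,
    (λ { t (E⊆D , _) → D⊆↓ t ∘ E⊆D }) ,
    (λ t → record
      -- All members of the family at `t` are `≐` to `D t`, so one number serves them all.
      { to        = λ _ → 0
      ; cong      = λ _ → refl
      ; injective = λ { {_ , E⊆D , D⊆E} {_ , F⊆D , D⊆F} _ →
                        (D⊆F ∘ E⊆D) , (D⊆E ∘ F⊆D) }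
      }) ,
    guess

  module _ (em : ExcludedMiddle (suc a)) where

    em′ : ExcludedMiddle a
    em′ = map′ lower lift (em {Lift (suc a) _})

    -- Each `t` is sent where the map for one chosen `B n` containing it sends it. A fibre over `v`
    -- then lies in the union of the countably many given fibres over `v`.
    NS-⋃ : {B : ℕ → Pred Node a} → (∀ n → NS T (B n)) → NS T (⋃ ℕ B)
    NS-⋃ {B} ns =
      record { to = λ { (t , t∈B) → value t∈B em′ }
             ; cong = λ { {_ , p} {_ , q} refl → value-irrelevant p q em′ } } ,
      (λ t∈B t≢root → value-regressive t∈B em′ t≢root) ,
      (λ v → special-⊆ (λ { (s∈B , eq) → value-fibre s∈B em′ eq })
                       (special-⋃ λ n → proj₂ (proj₂ (ns n)) v))
      where
      -- The index is taken from the decision, not from the membership proof,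
      -- so that the value does not depend on the latter.
      value : ∀ {t} → t ∈ ⋃ ℕ B → Dec (t ∈ ⋃ ℕ B) → Node
      value _   (yes (n , t∈Bn)) = Func.to (proj₁ (ns n)) (_ , t∈Bn)
      value t∈B (no t∉B)         = contradiction t∈B t∉B

      value-irrelevant : ∀ {t} (p q : t ∈ ⋃ ℕ B) d → value p d ≡ value q d
      value-irrelevant _ _ (yes _)  = refl
      value-irrelevant p _ (no t∉B) = contradiction p t∉B

      value-regressive : ∀ {t} (p : t ∈ ⋃ ℕ B) d → ¬ t ≡ root → value p d < t
      value-regressive _ (yes (n , t∈Bn)) = proj₁ (proj₂ (ns n)) t∈Bn
      value-regressive p (no t∉B)         = contradiction p t∉B

      value-fibre : ∀ {s v} (p : s ∈ ⋃ ℕ B) d → value p d ≡ v →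
                    s ∈ ⋃ ℕ (λ n → fibre T (proj₁ (ns n)) v)
      value-fibre _ (yes (n , s∈Bn)) eq = n , s∈Bn , eq
      value-fibre p (no s∉B)            = contradiction p s∉B

    -- Existence of offsets and of codes.

    Offset-exists : ∀ t → ∃ λ n → Offset n t
    Offset-exists t = go (<-wellFounded t)
      where
      go : ∀ {t} → Acc _<_ t → ∃ λ n → Offset n t
      go {t} (acc rs) with em′ {HasPred t}
      ... | no ¬p = 0 , t , ¬p , here
      ... | yes (_ , p) =
        let n , l , l¬ , c = go (rs (proj₁ p)) in ℕ.suc n , l , l¬ , step c p

    -- Replacing `t` by a node strictly between `s` and `t` must stop, and it stops at a successor
    -- of `s`.
    successor-towards : ∀ {s t} → s < t → ∃ λ u → s ⋖ u × (u ≡ t ⊎ u < t)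
    successor-towards {s} = go (<-wellFounded _)
      where
      go : ∀ {t} → Acc _<_ t → s < t → ∃ λ u → s ⋖ u × (u ≡ t ⊎ u < t)
      go {t} (acc rs) s<t with em′ {∃ λ r → s < r × r < t}
      ... | no ¬r = t , (s<t , ¬r) , inj₁ refl
      ... | yes (r , s<r , r<t) with go (rs r<t) s<r
      ...   | u , s⋖u , inj₁ refl = u , s⋖u , inj₂ r<t
      ...   | u , s⋖u , inj₂ u<r  = u , s⋖u , inj₂ (<-trans u<r r<t)

    -- A step towards `t` cannot land on `t`, which would then have an immediate predecessor.
    climb : ∀ {s t} → ¬ HasPred t → s < t → ∀ n → ∃ λ u → s ⋖[ n ] u × u < t
    climb t¬ s<t zero = _ , here , s<t
    climb t¬ s<t (ℕ.suc n) with climb t¬ s<t n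
    ... | u , c , u<t with successor-towards u<t
    ...   | v , u⋖v , inj₁ refl = contradiction (_ , u⋖v) t¬
    ...   | v , u⋖v , inj₂ v<t  = v , step c u⋖v , v<t

    -- Climbing from `s` stays below `t`, so some code of `s` survives the intersection with `t ↓`.
    decode-encode-⊇ : ∀ X m {t} → ¬ HasPred t →
                      X m ∩ (T ↓) t ⊆ decode m t (encode X ∩ (T ↓) t)
    decode-encode-⊇ X m t¬ {s} (s∈X , s<t) =
      let n , o       = Offset-exists s
          u , c , u<t = climb t¬ s<t ((m + n) * (m + n))
      in s<t , u , (n , o , c) , (m , s , (n , o , c) , s∈X) , u<t

    -- From `◇⁻` to `◇`.

    ◇⁻⇒◇ : ◇⁻ T → ◇ T
    ◇⁻⇒◇ (𝒟 , _ , _ , count , guess) = decidable-stable em λ ¬◇ →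
      let
        failure : ∀ n → ∃ λ X → NS T (λ t → X ∩ (T ↓) t ≐ decode n t (E t n))
        failure n = decidable-stable em λ ¬X →
          -- If no set refuted the guesses decoded at index `n`, they would form a `◇`-sequence.
          ¬◇ ((λ t → decode n t (E t n)) , (λ { _ (s<t , _) → s<t }) , λ X ns → ¬X (X , ns))

        X : ℕ → Pred Node a
        X n = proj₁ (failure n)
      in guess (encode X) (NS-⊆ (covered X) (NS-⋃ (pieces-NS X (proj₂ ∘ failure))))
      where
      module count t = Injection (count t)

      Numbered : Node → ℕ → Set (suc a)
      Numbered t n = ∃ λ D → ∃ λ (D∈𝒟 : D ∈ 𝒟 t) → count.to t (D , D∈𝒟) ≡ n

      member : ∀ {t n} → Dec (Numbered t n) → Pred Node a
      member (yes (D , _)) = D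
      member (no _)        = ∅

      -- Empty if no member of 𝒟 t has number n.
      E : Node → ℕ → Pred Node a
      E t n = member {t} {n} em

      -- The set picked for a number may differ from `D`, but equal numbers force the two to be `≐`.
      member-≐ : ∀ {t D} (D∈𝒟 : D ∈ 𝒟 t) (d : Dec (Numbered t (count.to t (D , D∈𝒟)))) →
                 D ≐ member d
      member-≐ {t} D∈𝒟 (yes (_ , _ , eq)) = count.injective t (sym eq)
      member-≐ D∈𝒟 (no ¬D)                = contradiction (_ , D∈𝒟 , refl) ¬D

      pieces : (ℕ → Pred Node a) → ℕ → Pred Node a
      -- Index 0 goes to the nodes with an immediate predecessor, which shifts the failure sets by
      -- one.
      pieces X zero      = HasPred
      pieces X (ℕ.suc n) = λ t → X n ∩ (T ↓) t ≐ decode n t (E t n)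

      pieces-NS : ∀ X → (∀ n → NS T (λ t → X n ∩ (T ↓) t ≐ decode n t (E t n))) →
                  ∀ n → NS T (pieces X n)
      pieces-NS X ns zero      = NS-hasPred
      pieces-NS X ns (ℕ.suc n) = ns n

      covered : ∀ X → (λ t → encode X ∩ (T ↓) t ∈ 𝒟 t) ⊆ ⋃ ℕ (pieces X)
      covered X {t} Y∈𝒟 with em′ {HasPred t}
      ... | yes p = 0 , p
      ... | no t¬ = ℕ.suc n , to , from
        where
        -- The diagonal step: the number of the guessed set in `𝒟 t` is also the index at which it
        -- is decoded.
        n = count.to t (_ , Y∈𝒟)

        Y≐E : encode X ∩ (T ↓) t ≐ E t n
        Y≐E = member-≐ Y∈𝒟 em

        to : X n ∩ (T ↓) t ⊆ decode n t (E t n)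
        to x = let s<t , u , c , u∈Y = decode-encode-⊇ X n t¬ x
               in s<t , u , c , proj₁ Y≐E u∈Y

        from : decode n t (E t n) ⊆ X n ∩ (T ↓) t
        from (s<t , u , c , u∈E) =
          decode-encode-⊆ X n t (s<t , u , c , proj₁ (proj₂ Y≐E u∈E)) , s<t

theorem3p9 : ∀ {a : Level} → ExcludedMiddle (suc a) →
    (T : Tree a) → Nonspecial T → WellPruned T → IsOmega₁Tree T →
    ◇⁻ T ⇔ ◇ T
theorem3p9 em T _ _ _ = mk⇔ (◇⁻⇒◇ T em) (◇⇒◇⁻ T)
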